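{- Let $X$ be a pre-Hilbert space, $C$ a convex subset of $X$ whose diameter is bounded by a positive natural number $b$, $U$ a nonexpansive function that maps $C$ into $C$, and $v_0$ a point of $C$. For any $k\in\mathbb{N}$ and $f:\mathbb{N}\to\mathbb{N}$, there is $N\in\mathbb{N}$ such that $N\leq(\tilde f+1)^{(r)}(0)$ and $$\exists x\in C\left(\|U(x)-x\|<\frac{1}{\tilde f(N)+1}\ \wedge\ \forall y\in C\left(\|U(y)-y\|\leq\frac{1}{N+1}\to\|x-v_0\|^2<\|y-v_0\|^2+\frac{1}{k+1}\right)\right),$$ where $r:=b^2(k+1)$ and $(\tilde f+1)^{(r)}$ is the $r$-fold composition of the function $\tilde f+1$.
   Context: $\mathbb{N}=\{0,1,2,\ldots\}$. For $f:\mathbb{N}\to\mathbb{N}$, $\tilde f(n):=\max_{k\leq n}f(k)$, and $\tilde f+1$ is the function $n\mapsto\tilde f(n)+1$. A map $U$ is nonexpansive if $\|U(x)-U(y)\|\leq\|x-y\|$ for all $x,y$. -}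

module Defs where

open import Algebra.Bundles using (CommutativeRing; Semiring)
open import Algebra.Module.Bundles using (LeftModule)
import Algebra.Construct.DirectProduct as DirectProduct
import Algebra.Definitions.RawSemiring as RawSemiringDefs
import Algebra.Solver.Ring.NaturalCoefficients.Default as RingSolver
open import Data.Nat.Base as ℕ using (ℕ; zero; suc)
open import Data.Product.Base using (∃; _×_; _,_; proj₁; proj₂)
open import Level using (0ℓ; _⊔_) renaming (suc to lsuc)
open import Relation.Binary.Core using (Rel)
open import Relation.Binary.Structures using (IsTotalOrder)
import Relation.Binary.Construct.NonStrictToStrict as ToStrict
open import Relation.Unary using (Pred; _∈_)

-- The real numbers, given axiomatically as a Dedekind-complete totally
-- ordered field (unique up to isomorphism).

record Reals : Set₁ where
  infix 4 _≤_
  infix 8 _⁻¹ 1/1+_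

  field
    commutativeRing : CommutativeRing 0ℓ 0ℓ

  open CommutativeRing commutativeRing public

  field
    _⁻¹ : Carrier → Carrier
    _≤_ : Rel Carrier 0ℓ

    -- Nothing is required of 0# ⁻¹.
    ⁻¹-inverseʳ    : ∀ x → x ≉ 0# → x * x ⁻¹ ≈ 1#
    0≉1            : 0# ≉ 1#
    ≤-isTotalOrder : IsTotalOrder _≈_ _≤_
    +-monoˡ-≤      : ∀ {x y} z → x ≤ y → x + z ≤ y + z
    *-nonneg       : ∀ {x y} → 0# ≤ x → 0# ≤ y → 0# ≤ x * y

  UpperBound : Pred Carrier 0ℓ → Pred Carrier 0ℓ
  UpperBound S u = ∀ {x} → x ∈ S → x ≤ u

  field
    complete : (S : Pred Carrier 0ℓ) → ∃ S → ∃ (UpperBound S) →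
               ∃ λ s → s ∈ UpperBound S × (∀ {u} → u ∈ UpperBound S → s ≤ u)

  open ToStrict _≈_ _≤_ public using (_<_)
  open RawSemiringDefs (Semiring.rawSemiring semiring) public using (_^_) renaming (_×_ to _·_)

  fromℕ : ℕ → Carrier
  fromℕ n = n · 1#

  1/1+_ : ℕ → Carrier
  1/1+ n = fromℕ (suc n) ⁻¹

data ScalarField : Set where
  real complex : ScalarField

module Scalars (ℝ : Reals) where
  open Reals ℝ

  -- (a , b) stands for a + b i.
  ℂ : CommutativeRing 0ℓ 0ℓ
  ℂ = record
    { _≈_ = ℂ₊._≈_
    ; _+_ = ℂ₊._+_
    -- (a + b i)(c + d i), using i² = -1
    ; _*_ = λ (a , b) (c , d) → a * c + (- 1#) * (b * d) , a * d + b * c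
    ; -_  = ℂ₊.-_
    ; 0#  = 0# , 0#
    ; 1#  = 1# , 0#
    ; isCommutativeRing = record
      { isRing = record
        { +-isAbelianGroup = ℂ₊.+-isAbelianGroup
        ; *-cong = λ (p , q) (r , s) →
            +-cong (*-cong p r) (*-congˡ (*-cong q s)) ,
            +-cong (*-cong p s) (*-cong q r)
        ; *-assoc = λ (a , b) (c , d) (e , f) →
            solve 7 (λ m a b c d e f →
              (a :* c :+ m :* (b :* d)) :* e :+ m :* ((a :* d :+ b :* c) :* f) :=
              a :* (c :* e :+ m :* (d :* f)) :+ m :* (b :* (c :* f :+ d :* e)))
              refl (- 1#) a b c d e f ,
            solve 7 (λ m a b c d e f →
              (a :* c :+ m :* (b :* d)) :* f :+ (a :* d :+ b :* c) :* e :=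
              a :* (c :* f :+ d :* e) :+ b :* (c :* e :+ m :* (d :* f)))
              refl (- 1#) a b c d e f
        ; *-identity =
            (λ (a , b) →
              solve 3 (λ m a b →
                con 1 :* a :+ m :* (con 0 :* b) := a) refl (- 1#) a b ,
              solve 2 (λ a b →
                con 1 :* b :+ con 0 :* a := b) refl a b) ,
            (λ (a , b) →
              solve 3 (λ m a b →
                a :* con 1 :+ m :* (b :* con 0) := a) refl (- 1#) a b ,
              solve 2 (λ a b →
                a :* con 0 :+ b :* con 1 := b) refl a b)
        ; distrib =
            (λ (a , b) (c , d) (e , f) →
              solve 7 (λ m a b c d e f →
                a :* (c :+ e) :+ m :* (b :* (d :+ f)) :=
                (a :* c :+ m :* (b :* d)) :+ (a :* e :+ m :* (b :* f)))
                refl (- 1#) a b c d e f ,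
              solve 6 (λ a b c d e f →
                a :* (d :+ f) :+ b :* (c :+ e) :=
                (a :* d :+ b :* c) :+ (a :* f :+ b :* e))
                refl a b c d e f) ,
            (λ (a , b) (c , d) (e , f) →
              solve 7 (λ m a b c d e f →
                (c :+ e) :* a :+ m :* ((d :+ f) :* b) :=
                (c :* a :+ m :* (d :* b)) :+ (e :* a :+ m :* (f :* b)))
                refl (- 1#) a b c d e f ,
              solve 6 (λ a b c d e f →
                (c :+ e) :* b :+ (d :+ f) :* a :=
                (c :* b :+ d :* a) :+ (e :* b :+ f :* a))
                refl a b c d e f)
        }
      ; *-comm = λ (a , b) (c , d) →
          solve 5 (λ m a b c d →
            a :* c :+ m :* (b :* d) := c :* a :+ m :* (d :* b))
            refl (- 1#) a b c d ,
          solve 4 (λ a b c d →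
            a :* d :+ b :* c := c :* b :+ d :* a) refl a b c d
      }
    }
    where
    module ℂ₊ = CommutativeRing
      (DirectProduct.commutativeRing commutativeRing commutativeRing)
    open RingSolver commutativeSemiring

  scalars : ScalarField → CommutativeRing 0ℓ 0ℓ
  scalars real    = commutativeRing
  scalars complex = ℂ

  private
    𝕂 : ScalarField → Set
    𝕂 𝕜 = CommutativeRing.Carrier (scalars 𝕜)

  ofReal : ∀ 𝕜 → Carrier → 𝕂 𝕜
  ofReal real    a = a
  ofReal complex a = a , 0#

  re : ∀ 𝕜 → 𝕂 𝕜 → Carrier
  re real    a       = a
  re complex (a , _) = a

  conj : ∀ 𝕜 → 𝕂 𝕜 → 𝕂 𝕜
  conj real    a       = a
  conj complex (a , b) = a , - b

record PreHilbertSpace (ℝ : Reals) (𝕜 : ScalarField) m ℓ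
                       : Set (lsuc (m ⊔ ℓ)) where
  open Scalars ℝ
  private
    module ℝ = Reals ℝ
    module 𝕂 = CommutativeRing (scalars 𝕜)

  field
    leftModule : LeftModule 𝕂.ring m ℓ

  open LeftModule leftModule public

  field
    ⟨_,_⟩ : Carrierᴹ → Carrierᴹ → 𝕂.Carrier

    ⟨⟩-cong     : ∀ {x x′ y y′} → x ≈ᴹ x′ → y ≈ᴹ y′ →
                  ⟨ x , y ⟩ 𝕂.≈ ⟨ x′ , y′ ⟩
    ⟨⟩-+ˡ       : ∀ x y z → ⟨ x +ᴹ y , z ⟩ 𝕂.≈ ⟨ x , z ⟩ 𝕂.+ ⟨ y , z ⟩
    ⟨⟩-*ˡ       : ∀ a x y → ⟨ a *ₗ x , y ⟩ 𝕂.≈ a 𝕂.* ⟨ x , y ⟩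
    ⟨⟩-conj     : ∀ x y → ⟨ x , y ⟩ 𝕂.≈ conj 𝕜 ⟨ y , x ⟩
    -- By ⟨⟩-conj, ⟨ x , x ⟩ equals its real part.
    ⟨⟩-nonneg   : ∀ x → ℝ.0# ℝ.≤ re 𝕜 ⟨ x , x ⟩
    ⟨⟩-definite : ∀ x → ⟨ x , x ⟩ 𝕂.≈ 𝕂.0# → x ≈ᴹ 0ᴹ

    -- The norm is bundled, but it is no extra datum: its two laws say exactly
    -- that ‖ x ‖ is the nonnegative square root of ⟨ x , x ⟩.
    ‖_‖      : Carrierᴹ → ℝ.Carrier
    ‖‖-nonneg : ∀ x → ℝ.0# ℝ.≤ ‖ x ‖
    ‖‖-square : ∀ x → ‖ x ‖ ℝ.^ 2 ℝ.≈ re 𝕜 ⟨ x , x ⟩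

  infixl 6 _-ᴹ_
  _-ᴹ_ : Carrierᴹ → Carrierᴹ → Carrierᴹ
  x -ᴹ y = x +ᴹ (-ᴹ y)

  infixr 7 _∙_
  _∙_ : ℝ.Carrier → Carrierᴹ → Carrierᴹ
  t ∙ x = ofReal 𝕜 t *ₗ x

  -- Subsets are predicates that respect ≈ᴹ; that condition is a separate
  -- hypothesis where it is needed.

  Convex : ∀ {p} → Pred Carrierᴹ p → Set (m ⊔ p)
  Convex C = ∀ {x y} t → x ∈ C → y ∈ C → ℝ.0# ℝ.≤ t → t ℝ.≤ ℝ.1# →
             (t ∙ x +ᴹ (ℝ.1# ℝ.- t) ∙ y) ∈ C

  DiameterBoundedBy : ∀ {p} → ℝ.Carrier → Pred Carrierᴹ p → Set (m ⊔ p)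
  DiameterBoundedBy d C = ∀ {x y} → x ∈ C → y ∈ C → ‖ x -ᴹ y ‖ ℝ.≤ d

  -- A map of C into C acts on ∃ C, whose elements are points paired with a
  -- membership proof.  Nonexpansiveness only sees the points, so it makes the
  -- values independent (up to ≈ᴹ) of the proofs and of representatives.
  Nonexpansive : ∀ {p} (C : Pred Carrierᴹ p) → (∃ C → ∃ C) → Set (m ⊔ p)
  Nonexpansive C U = ∀ x y →
    ‖ proj₁ (U x) -ᴹ proj₁ (U y) ‖ ℝ.≤ ‖ proj₁ x -ᴹ proj₁ y ‖

maxUpTo : (ℕ → ℕ) → ℕ → ℕ
maxUpTo f zero    = f zero
maxUpTo f (suc n) = maxUpTo f n ℕ.⊔ f (suc n)

{-# OPTIONS --safe #-}

-- Let Nᵢ = (f̃ + 1)⁽ⁱ⁾(0), so that 1/(Nᵢ₊₁ + 1) < 1/(f̃(Nᵢ) + 1).  Start from an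
-- approximate fixed point x of U for the stage N_r; it satisfies
-- ‖x - v₀‖² ≤ b² = r/(k + 1).  If (Nᵢ , x) is not as required, some y with
-- ‖U y - y‖ ≤ 1/(Nᵢ + 1) has ‖y - v₀‖² ≤ ‖x - v₀‖² - 1/(k + 1), and y is a
-- candidate for the stage Nᵢ₋₁.  The squared distance is nonnegative, so the
-- r + 1 stages N_r, …, N₀ cannot all fail.
module Submission where

open import Defs
open import Algebra.Bundles using (CommutativeRing)
import Algebra.Properties.Group as GroupProperties
import Algebra.Properties.Ring as RingProperties
import Algebra.Properties.Semiring.Mult as SemiringMult
import Algebra.Solver.Ring.NaturalCoefficients.Default as RingSolver
open import Axiom.ExcludedMiddle using (ExcludedMiddle)
open import Data.Nat.Base as ℕ using (ℕ; zero; suc)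
open import Data.Nat.GeneralisedArithmetic using (fold)
import Data.Nat.Properties as ℕ
open import Data.Product.Base using (∃; _×_; _,_; proj₁; proj₂)
open import Data.Sum.Base using (inj₁; inj₂)
open import Function.Base using (_∘_)
open import Level using (Level; 0ℓ; _⊔_; Lift; lift; lower)
open import Relation.Binary.Bundles using (Poset)
import Relation.Binary.Construct.NonStrictToStrict as ToStrict
open import Relation.Binary.Definitions using (_Respects_)
open import Relation.Binary.PropositionalEquality.Core as ≡ using (_≡_)
import Relation.Binary.Reasoning.PartialOrder as PosetReasoning
import Relation.Binary.Reasoning.Setoid as SetoidReasoning
open import Relation.Binary.Structures using (IsTotalOrder)
open import Relation.Nullary using (¬_; yes; no; contradiction)
open import Relation.Nullary.Decidable using (True; toWitness; fromWitness; map′)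
open import Relation.Unary using (Pred; _∈_)

private
  variable
    a : Level

-- The theorem assumes excluded middle at one joint level. Lifting a proposition to that level
-- decides it at the lower levels where the lemmas use it.
excludedMiddle-lower : ∀ a b → ExcludedMiddle (a ⊔ b) → ExcludedMiddle a
excludedMiddle-lower a b em {P} = map′ lower lift (em {Lift b P})

-- Order and arithmetic of the reals.

module RealProperties (ℝ : Reals) where
  open Reals ℝ
  open IsTotalOrder ≤-isTotalOrder public
    using (total; antisym; ≤-respˡ-≈; ≤-respʳ-≈; isPartialOrder)
    renaming (refl to ≤-refl; trans to ≤-trans; reflexive to ≤-reflexive)

  poset : Poset 0ℓ 0ℓ 0ℓ
  poset = record { isPartialOrder = isPartialOrder }

  module ≤-Reasoning = PosetReasoning poset
  open ≤-Reasoning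
  open RingProperties ring using (-1*x≈-x; -‿involutive)
  open GroupProperties +-group using (//-rightDividesˡ; //-rightDividesʳ)
  open SemiringMult semiring using (×1-homo-*)
  private
    module Solver = RingSolver commutativeSemiring

  ≰⇒> : ∀ {x y} → ¬ (x ≤ y) → y < x
  ≰⇒> = ToStrict.≰⇒> _≈_ _≤_ sym ≤-reflexive total

  <⇒≱ : ∀ {x y} → x < y → ¬ (y ≤ x)
  <⇒≱ = ToStrict.<⇒≱ _≈_ _≤_ antisym

  <-≤-trans : ∀ {x y z} → x < y → y ≤ z → x < z
  <-≤-trans = ToStrict.<-≤-trans _≈_ _≤_ sym ≤-trans antisym ≤-respʳ-≈

  ≤-<-trans : ∀ {x y z} → x ≤ y → y < z → x < z
  ≤-<-trans = ToStrict.≤-<-trans _≈_ _≤_ ≤-trans antisym ≤-respˡ-≈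

  +-monoʳ-≤ : ∀ z {x y} → x ≤ y → z + x ≤ z + y
  +-monoʳ-≤ z {x} {y} x≤y = begin
    z + x ≈⟨ +-comm z x ⟩
    x + z ≤⟨ +-monoˡ-≤ z x≤y ⟩
    y + z ≈⟨ +-comm y z ⟩
    z + y ∎

  +-mono-≤ : ∀ {x y u v} → x ≤ y → u ≤ v → x + u ≤ y + v
  +-mono-≤ {y = y} {u = u} x≤y u≤v = ≤-trans (+-monoˡ-≤ u x≤y) (+-monoʳ-≤ y u≤v)

  +-cancelʳ-≤ : ∀ z {x y} → x + z ≤ y + z → x ≤ y
  +-cancelʳ-≤ z {x} {y} x+z≤y+z = begin
    x         ≈⟨ //-rightDividesʳ z x ⟨
    x + z - z ≤⟨ +-monoˡ-≤ (- z) x+z≤y+z ⟩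
    y + z - z ≈⟨ //-rightDividesʳ z y ⟩
    y         ∎

  x≤x+y : ∀ x {y} → 0# ≤ y → x ≤ x + y
  x≤x+y x {y} 0≤y = begin
    x      ≈⟨ +-identityʳ x ⟨
    x + 0# ≤⟨ +-monoʳ-≤ x 0≤y ⟩
    x + y  ∎

  x<x+y : ∀ x {y} → 0# < y → x < x + y
  x<x+y x {y} 0<y = ≰⇒> λ x+y≤x → <⇒≱ 0<y (+-cancelʳ-≤ x (begin
    y + x  ≈⟨ +-comm y x ⟩
    x + y  ≤⟨ x+y≤x ⟩
    x      ≈⟨ +-identityˡ x ⟨
    0# + x ∎))

  x≤y⇒0≤y-x : ∀ {x y} → x ≤ y → 0# ≤ y - x
  x≤y⇒0≤y-x {x} {y} x≤y = begin
    0#    ≈⟨ -‿inverseʳ x ⟨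
    x - x ≤⟨ +-monoˡ-≤ (- x) x≤y ⟩
    y - x ∎

  *-monoˡ-≤ : ∀ {z x y} → 0# ≤ z → x ≤ y → z * x ≤ z * y
  *-monoˡ-≤ {z} {x} {y} 0≤z x≤y = begin
    z * x               ≤⟨ x≤x+y (z * x) (*-nonneg 0≤z (x≤y⇒0≤y-x x≤y)) ⟩
    z * x + z * (y - x) ≈⟨ distribˡ z x (y - x) ⟨
    z * (x + (y - x))   ≈⟨ *-congˡ (+-comm x (y - x)) ⟩
    z * ((y - x) + x)   ≈⟨ *-congˡ (//-rightDividesˡ x y) ⟩
    z * y               ∎

  *-monoʳ-≤ : ∀ {z x y} → 0# ≤ z → x ≤ y → x * z ≤ y * z
  *-monoʳ-≤ {z} {x} {y} 0≤z x≤y = begin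
    x * z ≈⟨ *-comm x z ⟩
    z * x ≤⟨ *-monoˡ-≤ 0≤z x≤y ⟩
    z * y ≈⟨ *-comm z y ⟩
    y * z ∎

  0≤1 : 0# ≤ 1#
  0≤1 with total 0# 1#
  ... | inj₁ 0≤1 = 0≤1
  -- If `1# ≤ 0#`, then `- 1#` is nonnegative, and so is its square, which is `1#`.
  ... | inj₂ 1≤0 = begin
    0#            ≤⟨ *-nonneg 0≤-1 0≤-1 ⟩
    - 1# * - 1#   ≈⟨ -1*x≈-x (- 1#) ⟩
    - - 1#        ≈⟨ -‿involutive 1# ⟩
    1#            ∎
    where
    0≤-1 : 0# ≤ - 1#
    0≤-1 = ≤-respʳ-≈ (+-identityˡ (- 1#)) (x≤y⇒0≤y-x 1≤0)

  0<1 : 0# < 1#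
  0<1 = 0≤1 , 0≉1

  0<⇒≉0 : ∀ {x} → 0# < x → x ≉ 0#
  0<⇒≉0 (_ , 0≉x) x≈0 = 0≉x (sym x≈0)

  ⁻¹-pos : ∀ {x} → 0# < x → 0# < x ⁻¹
  ⁻¹-pos {x} 0<x = ≰⇒> λ x⁻¹≤0 → <⇒≱ 0<1 (begin
    1#       ≈⟨ ⁻¹-inverseʳ x (0<⇒≉0 0<x) ⟨
    x * x ⁻¹ ≤⟨ *-monoˡ-≤ (proj₁ 0<x) x⁻¹≤0 ⟩
    x * 0#   ≈⟨ zeroʳ x ⟩
    0#       ∎)

  *-cancelˡ-≤ : ∀ {z x y} → 0# < z → z * x ≤ z * y → x ≤ y
  *-cancelˡ-≤ {z} {x} {y} 0<z zx≤zy = begin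
    x              ≈⟨ cancel x ⟨
    z ⁻¹ * (z * x) ≤⟨ *-monoˡ-≤ (proj₁ (⁻¹-pos 0<z)) zx≤zy ⟩
    z ⁻¹ * (z * y) ≈⟨ cancel y ⟩
    y              ∎
    where
    cancel : ∀ w → z ⁻¹ * (z * w) ≈ w
    cancel w = begin-equality
      z ⁻¹ * (z * w) ≈⟨ *-assoc (z ⁻¹) z w ⟨
      z ⁻¹ * z * w   ≈⟨ *-congʳ (*-comm (z ⁻¹) z) ⟩
      z * z ⁻¹ * w   ≈⟨ *-congʳ (⁻¹-inverseʳ z (0<⇒≉0 0<z)) ⟩
      1# * w         ≈⟨ *-identityˡ w ⟩
      w              ∎

  *-pos : ∀ {x y} → 0# < x → 0# < y → 0# < x * y
  *-pos {x} {y} 0<x 0<y = ≰⇒> λ xy≤0 →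
    <⇒≱ 0<y (*-cancelˡ-≤ 0<x (≤-respʳ-≈ (sym (zeroʳ x)) xy≤0))

  x^2≈x*x : ∀ x → x ^ 2 ≈ x * x
  x^2≈x*x x = *-congˡ (*-identityʳ x)

  square-mono-≤ : ∀ {x y} → 0# ≤ x → x ≤ y → x * x ≤ y * y
  square-mono-≤ 0≤x x≤y = ≤-trans (*-monoˡ-≤ 0≤x x≤y) (*-monoʳ-≤ (≤-trans 0≤x x≤y) x≤y)

  square-cancel-≤ : ExcludedMiddle 0ℓ → ∀ {x y} → 0# ≤ x → 0# ≤ y → x * x ≤ y * y → x ≤ y
  square-cancel-≤ em {x} {y} 0≤x 0≤y xx≤yy with em {x ≤ y}
  ... | yes x≤y = x≤y
  -- Here `y < x` makes `x` positive, so `x * x ≤ y * y ≤ x * y` can be divided by `x`. Totality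
  -- alone would give only `y ≤ x`, without this strictness.
  ... | no  x≰y = *-cancelˡ-≤ (≤-<-trans 0≤y y<x) (≤-trans xx≤yy (*-monoʳ-≤ 0≤y (proj₁ y<x)))
    where
    y<x : y < x
    y<x = ≰⇒> x≰y

  fromℕ-nonneg : ∀ n → 0# ≤ fromℕ n
  fromℕ-nonneg zero    = ≤-refl
  fromℕ-nonneg (suc n) = ≤-trans 0≤1 (x≤x+y 1# (fromℕ-nonneg n))

  fromℕ-suc-pos : ∀ n → 0# < fromℕ (suc n)
  fromℕ-suc-pos n = <-≤-trans 0<1 (x≤x+y 1# (fromℕ-nonneg n))

  fromℕ-* : ∀ m n → fromℕ (m ℕ.* n) ≈ fromℕ m * fromℕ n
  fromℕ-* = ×1-homo-*

  1/1+-pos : ∀ n → 0# < 1/1+ n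
  1/1+-pos n = ⁻¹-pos (fromℕ-suc-pos n)

  1/1+-inverseʳ : ∀ n → fromℕ (suc n) * 1/1+ n ≈ 1#
  1/1+-inverseʳ n = ⁻¹-inverseʳ (fromℕ (suc n)) (0<⇒≉0 (fromℕ-suc-pos n))

  1/1+-≤1 : ∀ n → 1/1+ n ≤ 1#
  1/1+-≤1 n = begin
    1/1+ n                         ≤⟨ x≤x+y (1/1+ n) (*-nonneg (fromℕ-nonneg n) (proj₁ (1/1+-pos n))) ⟩
    1/1+ n + fromℕ n * 1/1+ n      ≈⟨ +-congʳ (*-identityˡ (1/1+ n)) ⟨
    1# * 1/1+ n + fromℕ n * 1/1+ n ≈⟨ distribʳ (1/1+ n) 1# (fromℕ n) ⟨
    fromℕ (suc n) * 1/1+ n         ≈⟨ 1/1+-inverseʳ n ⟩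
    1#                             ∎

  1/1+-suc-< : ∀ n → 1/1+ (suc n) < 1/1+ n
  1/1+-suc-< n = ≰⇒> λ u≤v → <⇒≱ (x<x+y 1# (1/1+-pos (suc n))) (begin
    1# + v                  ≈⟨ +-congʳ (1/1+-inverseʳ n) ⟨
    c * u + v               ≤⟨ +-monoˡ-≤ v (*-monoˡ-≤ (fromℕ-nonneg (suc n)) u≤v) ⟩
    c * v + v               ≈⟨ solve 2 (λ c v → c :* v :+ v := (con 1 :+ c) :* v) refl c v ⟩
    fromℕ (suc (suc n)) * v ≈⟨ 1/1+-inverseʳ (suc n) ⟩
    1#                      ∎)
    where
    open Solver
    u v c : Carrier
    u = 1/1+ n
    v = 1/1+ (suc n)
    c = fromℕ (suc n)

  -- If φ stayed above ε, the infimum s of φ would satisfy s > 0 and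
  -- s + θ s ≤ s, since s + θ s ≤ φ (T x) + θ φ x ≤ (t + θ) φ x = φ x for every x.
  contraction⇒small :
    ∀ {A : Set a} → ExcludedMiddle a → (φ : A → Carrier) (T : A → A) (x₀ : A) →
    ∀ {θ t} → 0# < θ → t + θ ≈ 1# → (∀ x → φ (T x) ≤ t * φ x) →
    ∀ {ε} → 0# < ε → ∃ λ x → φ x ≤ ε
  contraction⇒small {A = A} em φ T x₀ {θ} {t} 0<θ t+θ≈1 contracts {ε} 0<ε
    with em {∃ λ x → φ x ≤ ε}
  ... | yes small = small
  ... | no ¬small = contradiction growth (<⇒≱ (x<x+y s (*-pos 0<θ 0<s)))
    where
    -- True compresses the statement to the level that completeness asks for.
    LowerBound : Pred Carrier 0ℓ
    LowerBound u = True (em {∀ x → u ≤ φ x})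

    ε-lower : ε ∈ LowerBound
    ε-lower = fromWitness λ x → proj₁ (≰⇒> λ φx≤ε → ¬small (x , φx≤ε))

    -- `complete` yields suprema, so the infimum of `φ` is taken as the supremum of its lower
    -- bounds. These include `ε` and are bounded above by `φ x₀`.
    supremum : ∃ λ s → UpperBound LowerBound s × (∀ {u} → UpperBound LowerBound u → s ≤ u)
    supremum = complete LowerBound (ε , ε-lower) (φ x₀ , λ u-lower → toWitness u-lower x₀)

    s : Carrier
    s = proj₁ supremum

    s≤φ : ∀ x → s ≤ φ x
    s≤φ x = proj₂ (proj₂ supremum) λ u-lower → toWitness u-lower x

    0<s : 0# < s
    0<s = <-≤-trans 0<ε (proj₁ (proj₂ supremum) ε-lower)

    growth : s + θ * s ≤ s
    growth = proj₁ (proj₂ supremum) (fromWitness λ x → begin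
      s + θ * s         ≤⟨ +-mono-≤ (≤-trans (s≤φ (T x)) (contracts x)) (*-monoˡ-≤ (proj₁ 0<θ) (s≤φ x)) ⟩
      t * φ x + θ * φ x ≈⟨ distribʳ (φ x) t θ ⟨
      (t + θ) * φ x     ≈⟨ *-congʳ t+θ≈1 ⟩
      1# * φ x          ≈⟨ *-identityˡ (φ x) ⟩
      φ x               ∎)

-- Real parts and real scalars, for both scalar fields.

module ScalarProperties (ℝ : Reals) where
  open Reals ℝ
  open Scalars ℝ
  open RingSolver commutativeSemiring
  private
    module 𝕂 (𝕜 : ScalarField) = CommutativeRing (scalars 𝕜)

  re-cong : ∀ 𝕜 {z w} → 𝕂._≈_ 𝕜 z w → re 𝕜 z ≈ re 𝕜 w
  re-cong real    z≈w       = z≈w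
  re-cong complex (a≈c , _) = a≈c

  re-+ : ∀ 𝕜 z w → re 𝕜 (𝕂._+_ 𝕜 z w) ≈ re 𝕜 z + re 𝕜 w
  re-+ real    z w = refl
  re-+ complex z w = refl

  re-conj : ∀ 𝕜 z → re 𝕜 (conj 𝕜 z) ≈ re 𝕜 z
  re-conj real    z = refl
  re-conj complex z = refl

  re-ofReal-* : ∀ 𝕜 t z → re 𝕜 (𝕂._*_ 𝕜 (ofReal 𝕜 t) z) ≈ t * re 𝕜 z
  re-ofReal-* real    t z       = refl
  re-ofReal-* complex t (a , b) =
    solve 4 (λ m t a b → t :* a :+ m :* (con 0 :* b) := t :* a) refl (- 1#) t a b

  ofReal-cong : ∀ 𝕜 {s t} → s ≈ t → 𝕂._≈_ 𝕜 (ofReal 𝕜 s) (ofReal 𝕜 t)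
  ofReal-cong real    s≈t = s≈t
  ofReal-cong complex s≈t = s≈t , refl

  ofReal-+ : ∀ 𝕜 s t → 𝕂._≈_ 𝕜 (ofReal 𝕜 (s + t)) (𝕂._+_ 𝕜 (ofReal 𝕜 s) (ofReal 𝕜 t))
  ofReal-+ real    s t = refl
  ofReal-+ complex s t = refl , sym (+-identityʳ 0#)

  ofReal-1 : ∀ 𝕜 → 𝕂._≈_ 𝕜 (ofReal 𝕜 1#) (𝕂.1# 𝕜)
  ofReal-1 real    = refl
  ofReal-1 complex = refl , refl

-- Norm estimates in a pre-Hilbert space.

module PreHilbertProperties
  {ℝ : Reals} {𝕜 : ScalarField} {m ℓ : Level} (X : PreHilbertSpace ℝ 𝕜 m ℓ) where
  open Reals ℝ
  open Scalars ℝ using (re)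
  open PreHilbertSpace X
  open RealProperties ℝ
  open ≤-Reasoning
  open ScalarProperties ℝ
  open GroupProperties +ᴹ-group public using () renaming (//-rightDividesˡ to x-y+y≈x)
  private
    module Solver = RingSolver commutativeSemiring

  ∙-distribˡ : ∀ t x y → t ∙ (x +ᴹ y) ≈ᴹ t ∙ x +ᴹ t ∙ y
  ∙-distribˡ t = *ₗ-distribˡ _

  ∙-distribʳ : ∀ x s t → (s + t) ∙ x ≈ᴹ s ∙ x +ᴹ t ∙ x
  ∙-distribʳ x s t = ≈ᴹ-trans (*ₗ-congʳ (ofReal-+ 𝕜 s t)) (*ₗ-distribʳ x _ _)

  ∙-congʳ : ∀ {s t x} → s ≈ t → s ∙ x ≈ᴹ t ∙ x
  ∙-congʳ s≈t = *ₗ-congʳ (ofReal-cong 𝕜 s≈t)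

  ∙-identityˡ : ∀ x → 1# ∙ x ≈ᴹ x
  ∙-identityˡ x = ≈ᴹ-trans (*ₗ-congʳ (ofReal-1 𝕜)) (*ₗ-identityˡ x)

  -- The real part is a symmetric real-bilinear form with the same squared norms, so real and
  -- complex spaces can be treated alike.
  ⟪_,_⟫ : Carrierᴹ → Carrierᴹ → Carrier
  ⟪ x , y ⟫ = re 𝕜 ⟨ x , y ⟩

  ⟪⟫-cong : ∀ {x x′ y y′} → x ≈ᴹ x′ → y ≈ᴹ y′ → ⟪ x , y ⟫ ≈ ⟪ x′ , y′ ⟫
  ⟪⟫-cong x≈x′ y≈y′ = re-cong 𝕜 (⟨⟩-cong x≈x′ y≈y′)

  ⟪⟫-sym : ∀ x y → ⟪ x , y ⟫ ≈ ⟪ y , x ⟫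
  ⟪⟫-sym x y = trans (re-cong 𝕜 (⟨⟩-conj x y)) (re-conj 𝕜 _)

  ⟪⟫-+ˡ : ∀ x y z → ⟪ x +ᴹ y , z ⟫ ≈ ⟪ x , z ⟫ + ⟪ y , z ⟫
  ⟪⟫-+ˡ x y z = trans (re-cong 𝕜 (⟨⟩-+ˡ x y z)) (re-+ 𝕜 _ _)

  ⟪⟫-∙ˡ : ∀ t x y → ⟪ t ∙ x , y ⟫ ≈ t * ⟪ x , y ⟫
  ⟪⟫-∙ˡ t x y = trans (re-cong 𝕜 (⟨⟩-*ˡ _ x y)) (re-ofReal-* 𝕜 t _)

  ⟪⟫-∙ : ∀ s t x y → ⟪ s ∙ x , t ∙ y ⟫ ≈ s * (t * ⟪ x , y ⟫)
  ⟪⟫-∙ s t x y = begin-equality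
    ⟪ s ∙ x , t ∙ y ⟫     ≈⟨ ⟪⟫-∙ˡ s x (t ∙ y) ⟩
    s * ⟪ x , t ∙ y ⟫     ≈⟨ *-congˡ (⟪⟫-sym x (t ∙ y)) ⟩
    s * ⟪ t ∙ y , x ⟫     ≈⟨ *-congˡ (⟪⟫-∙ˡ t y x) ⟩
    s * (t * ⟪ y , x ⟫)   ≈⟨ *-congˡ (*-congˡ (⟪⟫-sym y x)) ⟩
    s * (t * ⟪ x , y ⟫)   ∎

  -- Taken from the form rather than from `‖_‖`, so that it expands bilinearly and respects `_≈ᴹ_`
  -- at once.
  ‖_‖² : Carrierᴹ → Carrier
  ‖ x ‖² = ⟪ x , x ⟫

  ‖x‖*‖x‖≈‖x‖² : ∀ x → ‖ x ‖ * ‖ x ‖ ≈ ‖ x ‖²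
  ‖x‖*‖x‖≈‖x‖² x = trans (sym (x^2≈x*x ‖ x ‖)) (‖‖-square x)

  ‖‖²-+ : ∀ x y → ‖ x +ᴹ y ‖² ≈ ‖ x ‖² + (⟪ x , y ⟫ + ⟪ x , y ⟫) + ‖ y ‖²
  ‖‖²-+ x y = begin-equality
    ‖ x +ᴹ y ‖²                           ≈⟨ ⟪⟫-+ˡ x y (x +ᴹ y) ⟩
    ⟪ x , x +ᴹ y ⟫ + ⟪ y , x +ᴹ y ⟫       ≈⟨ +-cong (expand x) (expand y) ⟩
    (‖ x ‖² + ⟪ y , x ⟫) + (⟪ x , y ⟫ + ‖ y ‖²)
      ≈⟨ +-congʳ (+-congˡ (⟪⟫-sym y x)) ⟩
    (‖ x ‖² + ⟪ x , y ⟫) + (⟪ x , y ⟫ + ‖ y ‖²)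
      ≈⟨ solve 3 (λ p q r → (p :+ r) :+ (r :+ q) := p :+ (r :+ r) :+ q) refl ‖ x ‖² ‖ y ‖² ⟪ x , y ⟫ ⟩
    ‖ x ‖² + (⟪ x , y ⟫ + ⟪ x , y ⟫) + ‖ y ‖² ∎
    where
    open Solver
    expand : ∀ z → ⟪ z , x +ᴹ y ⟫ ≈ ⟪ x , z ⟫ + ⟪ y , z ⟫
    expand z = trans (⟪⟫-sym z (x +ᴹ y)) (⟪⟫-+ˡ x y z)

  -- With w = x - y, the right-hand side exceeds the left-hand side by ‖ w ‖².
  2⟪x,y⟫≤‖x‖²+‖y‖² : ∀ x y → ⟪ x , y ⟫ + ⟪ x , y ⟫ ≤ ‖ x ‖² + ‖ y ‖²
  2⟪x,y⟫≤‖x‖²+‖y‖² x y = begin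
    ⟪ x , y ⟫ + ⟪ x , y ⟫            ≤⟨ x≤x+y _ (⟨⟩-nonneg w) ⟩
    ⟪ x , y ⟫ + ⟪ x , y ⟫ + ‖ w ‖²   ≈⟨ +-congʳ (+-cong ⟪x,y⟫≈ ⟪x,y⟫≈) ⟩
    (⟪ w , y ⟫ + ‖ y ‖²) + (⟪ w , y ⟫ + ‖ y ‖²) + ‖ w ‖²
      ≈⟨ solve 3 (λ p q r → (r :+ q) :+ (r :+ q) :+ p := (p :+ (r :+ r) :+ q) :+ q) refl ‖ w ‖² ‖ y ‖² ⟪ w , y ⟫ ⟩
    ‖ w ‖² + (⟪ w , y ⟫ + ⟪ w , y ⟫) + ‖ y ‖² + ‖ y ‖²
                                     ≈⟨ +-congʳ (‖‖²-+ w y) ⟨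
    ‖ w +ᴹ y ‖² + ‖ y ‖²             ≈⟨ +-congʳ (⟪⟫-cong w+y≈x w+y≈x) ⟩
    ‖ x ‖² + ‖ y ‖²                  ∎
    where
    open Solver
    w : Carrierᴹ
    w = x -ᴹ y

    w+y≈x : w +ᴹ y ≈ᴹ x
    w+y≈x = x-y+y≈x y x

    ⟪x,y⟫≈ : ⟪ x , y ⟫ ≈ ⟪ w , y ⟫ + ‖ y ‖²
    ⟪x,y⟫≈ = trans (⟪⟫-cong (≈ᴹ-sym w+y≈x) ≈ᴹ-refl) (⟪⟫-+ˡ w y y)

  module _ (em : ExcludedMiddle 0ℓ) where

    -- The norm is given through its square and its sign, so every bound on a norm is reduced by
    -- this lemma to one on inner products.
    ‖‖-≤ : ∀ {x α} → 0# ≤ α → ‖ x ‖² ≤ α * α → ‖ x ‖ ≤ α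
    ‖‖-≤ {x} 0≤α x²≤α² = square-cancel-≤ em (‖‖-nonneg x) 0≤α
      (≤-respˡ-≈ (sym (‖x‖*‖x‖≈‖x‖² x)) x²≤α²)

    ‖‖-cong-≤ : ∀ {x y} → x ≈ᴹ y → ‖ x ‖ ≤ ‖ y ‖
    ‖‖-cong-≤ {x} {y} x≈y = ‖‖-≤ (‖‖-nonneg y)
      (≤-reflexive (trans (⟪⟫-cong x≈y x≈y) (sym (‖x‖*‖x‖≈‖x‖² y))))

    ‖t∙x‖≤t*‖x‖ : ∀ {t} x → 0# ≤ t → ‖ t ∙ x ‖ ≤ t * ‖ x ‖
    ‖t∙x‖≤t*‖x‖ {t} x 0≤t = ‖‖-≤ (*-nonneg 0≤t (‖‖-nonneg x)) (≤-reflexive (begin-equality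
      ‖ t ∙ x ‖²                  ≈⟨ ⟪⟫-∙ t t x x ⟩
      t * (t * ‖ x ‖²)            ≈⟨ *-congˡ (*-congˡ (‖x‖*‖x‖≈‖x‖² x)) ⟨
      t * (t * (‖ x ‖ * ‖ x ‖))   ≈⟨ solve 2 (λ t n → t :* (t :* (n :* n)) := (t :* n) :* (t :* n)) refl t ‖ x ‖ ⟩
      t * ‖ x ‖ * (t * ‖ x ‖)     ∎))
      where open Solver

    -- Strict positivity of the bounds makes this a direct consequence of
    -- 2⟪βx,αy⟫ ≤ ‖βx‖² + ‖αy‖², without the degenerate cases of Cauchy–Schwarz.
    ‖x+y‖≤α+β : ∀ {x y α β} → 0# < α → 0# < β → ‖ x ‖ ≤ α → ‖ y ‖ ≤ β → ‖ x +ᴹ y ‖ ≤ α + β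
    ‖x+y‖≤α+β {x} {y} {α} {β} 0<α 0<β ‖x‖≤α ‖y‖≤β =
      -- The factor `α * β` turns the cross term into the product of `β ∙ x` and `α ∙ y`, vectors
      -- rescaled to have the common norm bound `α * β`.
      ‖‖-≤ 0≤α+β (*-cancelˡ-≤ (*-pos 0<α 0<β) (begin
        α * β * ‖ x +ᴹ y ‖²   ≈⟨ *-congˡ (‖‖²-+ x y) ⟩
        α * β * (‖ x ‖² + (⟪ x , y ⟫ + ⟪ x , y ⟫) + ‖ y ‖²)
          ≈⟨ solve 5 (λ α β p q r →
               α :* β :* (p :+ (r :+ r) :+ q) :=
               α :* β :* (p :+ q) :+ (β :* (α :* r) :+ β :* (α :* r)))
             refl α β ‖ x ‖² ‖ y ‖² ⟪ x , y ⟫ ⟩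
        α * β * (‖ x ‖² + ‖ y ‖²) + (β * (α * ⟪ x , y ⟫) + β * (α * ⟪ x , y ⟫))
          ≈⟨ +-congˡ (+-cong (⟪⟫-∙ β α x y) (⟪⟫-∙ β α x y)) ⟨
        α * β * (‖ x ‖² + ‖ y ‖²) + (⟪ β ∙ x , α ∙ y ⟫ + ⟪ β ∙ x , α ∙ y ⟫)
          ≤⟨ +-monoʳ-≤ _ (2⟪x,y⟫≤‖x‖²+‖y‖² (β ∙ x) (α ∙ y)) ⟩
        α * β * (‖ x ‖² + ‖ y ‖²) + (‖ β ∙ x ‖² + ‖ α ∙ y ‖²)
          ≈⟨ +-congˡ (+-cong (⟪⟫-∙ β β x x) (⟪⟫-∙ α α y y)) ⟩
        α * β * (‖ x ‖² + ‖ y ‖²) + (β * (β * ‖ x ‖²) + α * (α * ‖ y ‖²))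
          ≈⟨ solve 4 (λ α β p q →
               α :* β :* (p :+ q) :+ (β :* (β :* p) :+ α :* (α :* q)) :=
               (α :+ β) :* (β :* p :+ α :* q))
             refl α β ‖ x ‖² ‖ y ‖² ⟩
        (α + β) * (β * ‖ x ‖² + α * ‖ y ‖²)
          ≤⟨ *-monoˡ-≤ 0≤α+β (+-mono-≤ (*-monoˡ-≤ (proj₁ 0<β) (‖‖²-≤ ‖x‖≤α))
                                       (*-monoˡ-≤ (proj₁ 0<α) (‖‖²-≤ ‖y‖≤β))) ⟩
        (α + β) * (β * (α * α) + α * (β * β))
          ≈⟨ solve 2 (λ α β →
               (α :+ β) :* (β :* (α :* α) :+ α :* (β :* β)) :=
               α :* β :* ((α :+ β) :* (α :+ β)))
             refl α β ⟩
        α * β * ((α + β) * (α + β)) ∎))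
      where
      open Solver
      0≤α+β : 0# ≤ α + β
      0≤α+β = ≤-trans (proj₁ 0<α) (x≤x+y α (proj₁ 0<β))

      ‖‖²-≤ : ∀ {z γ} → ‖ z ‖ ≤ γ → ‖ z ‖² ≤ γ * γ
      ‖‖²-≤ {z} ‖z‖≤γ = ≤-respˡ-≈ (‖x‖*‖x‖≈‖x‖² z) (square-mono-≤ (‖‖-nonneg z) ‖z‖≤γ)

-- Approximate fixed points of a nonexpansive map, and the descent through them.

module NonexpansiveProperties
  {ℝ : Reals} {𝕜 : ScalarField} {m ℓ p : Level} (X : PreHilbertSpace ℝ 𝕜 m ℓ)
  {C : Pred (PreHilbertSpace.Carrierᴹ X) p}
  (U : ∃ C → ∃ C) where
  open Reals ℝ
  open PreHilbertSpace X
  open RealProperties ℝ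
  open PreHilbertProperties X
  open GroupProperties +ᴹ-group using (x≈z//y)
  private
    module ≈ᴹ-Reasoning = SetoidReasoning ≈ᴹ-setoid

  residual : ∃ C → Carrier
  residual x = ‖ proj₁ (U x) -ᴹ proj₁ x ‖

  -- Applies contraction⇒small to T x = θ v₀ + (1 - θ) U x, a contraction of C
  -- that is uniformly close to U.
  approximateFixedPoint :
    ExcludedMiddle 0ℓ → ExcludedMiddle (m ⊔ p) → Convex C →
    ∀ b → 0 ℕ.< b → DiameterBoundedBy (fromℕ b) C → Nonexpansive C U →
    ∃ C → ∀ n → ∃ λ x → residual x ≤ 1/1+ n
  approximateFixedPoint em₀ em convex (suc b) _ bounded nonexpansive (v , v∈C) n =
    proj₁ almostFixed , residual≤
    where
    B θ t : Carrier
    B = fromℕ (suc b)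
    -- Chosen so that `θ + θ * B` is `1/1+ n`: `θ` is spent on the residual of `T` and `θ * B` on
    -- the distance from `T` to `U`. Note that `1/1+ (suc b)` is the inverse of `1# + B`.
    θ = 1/1+ n * 1/1+ (suc b)
    t = 1# - θ

    0<θ : 0# < θ
    0<θ = *-pos (1/1+-pos n) (1/1+-pos (suc b))

    θ≤1 : θ ≤ 1#
    θ≤1 = begin
      θ            ≤⟨ *-monoˡ-≤ (proj₁ (1/1+-pos n)) (1/1+-≤1 (suc b)) ⟩
      1/1+ n * 1#  ≈⟨ *-identityʳ (1/1+ n) ⟩
      1/1+ n       ≤⟨ 1/1+-≤1 n ⟩
      1#           ∎
      where open ≤-Reasoning

    0≤t : 0# ≤ t
    0≤t = x≤y⇒0≤y-x θ≤1

    t+θ≈1 : t + θ ≈ 1#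
    t+θ≈1 = GroupProperties.//-rightDividesˡ +-group θ 1#

    T : ∃ C → ∃ C
    T x = θ ∙ v +ᴹ t ∙ proj₁ (U x) , convex θ v∈C (proj₂ (U x)) (proj₁ 0<θ) θ≤1

    -- The common term `θ ∙ v` cancels. Adding `proj₁ (T y)` to both sides first avoids expanding
    -- its negative.
    T-difference : ∀ x y → proj₁ (T x) -ᴹ proj₁ (T y) ≈ᴹ t ∙ (proj₁ (U x) -ᴹ proj₁ (U y))
    T-difference x y = ≈ᴹ-sym (x≈z//y _ _ _ (begin
      t ∙ (u -ᴹ w) +ᴹ (θ ∙ v +ᴹ t ∙ w)  ≈⟨ +ᴹ-congˡ (+ᴹ-comm _ _) ⟩
      t ∙ (u -ᴹ w) +ᴹ (t ∙ w +ᴹ θ ∙ v)  ≈⟨ +ᴹ-assoc _ _ _ ⟨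
      t ∙ (u -ᴹ w) +ᴹ t ∙ w +ᴹ θ ∙ v    ≈⟨ +ᴹ-congʳ (∙-distribˡ t _ _) ⟨
      t ∙ (u -ᴹ w +ᴹ w) +ᴹ θ ∙ v        ≈⟨ +ᴹ-congʳ (*ₗ-congˡ (x-y+y≈x w u)) ⟩
      t ∙ u +ᴹ θ ∙ v                    ≈⟨ +ᴹ-comm _ _ ⟩
      θ ∙ v +ᴹ t ∙ u                    ∎))
      where
      open ≈ᴹ-Reasoning
      u w : Carrierᴹ
      u = proj₁ (U x)
      w = proj₁ (U y)

    -- `U x` differs from the convex combination `T x` by `θ ∙ (proj₁ (U x) -ᴹ v)`, whose norm is at
    -- most `θ * B`.
    residual-decomposition : ∀ x →
      proj₁ (U x) -ᴹ proj₁ x ≈ᴹ (proj₁ (T x) -ᴹ proj₁ x) +ᴹ θ ∙ (proj₁ (U x) -ᴹ v)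
    residual-decomposition (x , x∈C) = ≈ᴹ-sym (x≈z//y _ _ _ (begin
      (Tx -ᴹ x +ᴹ d) +ᴹ x             ≈⟨ +ᴹ-assoc _ _ _ ⟩
      Tx -ᴹ x +ᴹ (d +ᴹ x)             ≈⟨ +ᴹ-congˡ (+ᴹ-comm _ _) ⟩
      Tx -ᴹ x +ᴹ (x +ᴹ d)             ≈⟨ +ᴹ-assoc _ _ _ ⟨
      Tx -ᴹ x +ᴹ x +ᴹ d               ≈⟨ +ᴹ-congʳ (x-y+y≈x x Tx) ⟩
      θ ∙ v +ᴹ t ∙ u +ᴹ θ ∙ (u -ᴹ v)  ≈⟨ +ᴹ-congʳ (+ᴹ-comm _ _) ⟩
      t ∙ u +ᴹ θ ∙ v +ᴹ θ ∙ (u -ᴹ v)  ≈⟨ +ᴹ-assoc _ _ _ ⟩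
      t ∙ u +ᴹ (θ ∙ v +ᴹ θ ∙ (u -ᴹ v)) ≈⟨ +ᴹ-congˡ (∙-distribˡ θ _ _) ⟨
      t ∙ u +ᴹ θ ∙ (v +ᴹ (u -ᴹ v))    ≈⟨ +ᴹ-congˡ (*ₗ-congˡ (≈ᴹ-trans (+ᴹ-comm _ _) (x-y+y≈x v u))) ⟩
      t ∙ u +ᴹ θ ∙ u                  ≈⟨ ∙-distribʳ u t θ ⟨
      (t + θ) ∙ u                     ≈⟨ ∙-congʳ t+θ≈1 ⟩
      1# ∙ u                          ≈⟨ ∙-identityˡ u ⟩
      u                               ∎))
      where
      open ≈ᴹ-Reasoning
      u d Tx : Carrierᴹ
      u = proj₁ (U (x , x∈C))
      d = θ ∙ (u -ᴹ v)
      Tx = proj₁ (T (x , x∈C))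

    T-residual : ∃ C → Carrier
    T-residual x = ‖ proj₁ (T x) -ᴹ proj₁ x ‖

    -- The residual of `T` at `T x` is the distance between the `T`-images of `T x` and `x`, so it
    -- inherits the factor `t`.
    T-contracts : ∀ x → T-residual (T x) ≤ t * T-residual x
    T-contracts x = begin
      T-residual (T x)                           ≤⟨ ‖‖-cong-≤ em₀ (T-difference (T x) x) ⟩
      ‖ t ∙ (proj₁ (U (T x)) -ᴹ proj₁ (U x)) ‖   ≤⟨ ‖t∙x‖≤t*‖x‖ em₀ _ 0≤t ⟩
      t * ‖ proj₁ (U (T x)) -ᴹ proj₁ (U x) ‖     ≤⟨ *-monoˡ-≤ 0≤t (nonexpansive (T x) x) ⟩
      t * T-residual x                           ∎
      where open ≤-Reasoning

    almostFixed : ∃ λ x → T-residual x ≤ θ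
    -- The same `θ` serves as the contraction gap and, through the last argument, as the tolerance.
    almostFixed = contraction⇒small em T-residual T (v , v∈C) 0<θ t+θ≈1 T-contracts 0<θ

    residual≤ : residual (proj₁ almostFixed) ≤ 1/1+ n
    residual≤ = begin
      residual x                              ≤⟨ ‖‖-cong-≤ em₀ (residual-decomposition x) ⟩
      ‖ (proj₁ (T x) -ᴹ proj₁ x) +ᴹ θ ∙ (proj₁ (U x) -ᴹ v) ‖
        -- This triangle inequality asks for strictly positive bounds; `θ * B` is one because the
        -- diameter bound is a successor.
        ≤⟨ ‖x+y‖≤α+β em₀ 0<θ (*-pos 0<θ (fromℕ-suc-pos b)) (proj₂ almostFixed)
             (≤-trans (‖t∙x‖≤t*‖x‖ em₀ _ (proj₁ 0<θ))
                      (*-monoˡ-≤ (proj₁ 0<θ) (bounded (proj₂ (U x)) v∈C))) ⟩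
      θ + θ * B                               ≈⟨ solve 3 (λ p q B → p :* q :+ p :* q :* B := p :* ((con 1 :+ B) :* q)) refl _ _ B ⟩
      1/1+ n * ((1# + B) * 1/1+ (suc b))      ≈⟨ *-congˡ (1/1+-inverseʳ (suc b)) ⟩
      1/1+ n * 1#                             ≈⟨ *-identityʳ (1/1+ n) ⟩
      1/1+ n                                  ∎
      where
      open ≤-Reasoning
      open RingSolver commutativeSemiring
      x : ∃ C
      x = proj₁ almostFixed

  -- Induction on the stage `i` with invariant `D x ≤ fromℕ i * 1/1+ k`: an improving point costs
  -- one stage and lowers `D` by at least `1/1+ k`. Here `f` is to be the running maximum and `N`
  -- its orbit, so `N-mono` keeps the bound on `n` valid for the larger stages.
  descent :
    ExcludedMiddle (m ⊔ p) → (D : ∃ C → Carrier) → (∀ x → 0# ≤ D x) →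
    (k : ℕ) (f : ℕ → ℕ) (N : ℕ → ℕ) →
    (∀ i → N i ℕ.≤ N (suc i)) → (∀ i → N (suc i) ≡ suc (f (N i))) →
    ∀ i x → residual x < 1/1+ (f (N i)) → D x ≤ fromℕ i * 1/1+ k →
    ∃ λ n → n ℕ.≤ N i × ∃ λ x → residual x < 1/1+ (f n) ×
      (∀ y → residual y ≤ 1/1+ n → D x < D y + 1/1+ k)
  descent em D 0≤D k f N N-mono N-suc i x x-fixed Dx≤
    with em {∃ λ y → residual y ≤ 1/1+ (N i) × D y + 1/1+ k ≤ D x}
  ... | no ¬improvable =
    N i , ℕ.≤-refl , x , x-fixed , λ y y-fixed →
      ≰⇒> λ improves → ¬improvable (y , y-fixed , improves)
  -- The budget is spent: `D x ≤ 0#`, yet `D x` is at least the positive number `D y + 1/1+ k`.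
  descent em D 0≤D k f N N-mono N-suc zero x x-fixed Dx≤ | yes (y , _ , improves) =
    contradiction Dy+e≤0 (<⇒≱ (≤-<-trans (0≤D y) (x<x+y (D y) (1/1+-pos k))))
    where
    Dy+e≤0 : D y + 1/1+ k ≤ 0#
    Dy+e≤0 = ≤-trans improves (≤-respʳ-≈ (zeroˡ (1/1+ k)) Dx≤)
  descent em D 0≤D k f N N-mono N-suc (suc i) x x-fixed Dx≤ | yes (y , y-fixed , improves) =
    let n , n≤ , rest = descent em D 0≤D k f N N-mono N-suc i y y-fixed′ Dy≤
    in n , ℕ.≤-trans n≤ (N-mono i) , rest
    where
    e : Carrier
    e = 1/1+ k

    -- The successor in `N-suc` makes the non-strict bound `1/1+ (N (suc i))` on `y` the strict one
    -- required at stage `i`.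
    y-fixed′ : residual y < 1/1+ (f (N i))
    y-fixed′ = ≤-<-trans (≡.subst (λ n → residual y ≤ 1/1+ n) (N-suc i) y-fixed)
                         (1/1+-suc-< (f (N i)))

    Dy≤ : D y ≤ fromℕ i * e
    Dy≤ = +-cancelʳ-≤ e (begin
      D y + e             ≤⟨ improves ⟩
      D x                 ≤⟨ Dx≤ ⟩
      (1# + fromℕ i) * e  ≈⟨ solve 2 (λ c e → (con 1 :+ c) :* e := c :* e :+ e) refl (fromℕ i) e ⟩
      fromℕ i * e + e     ∎)
      where
      open ≤-Reasoning
      open RingSolver commutativeSemiring

-- Monotonicity of the running maximum and of its orbit.

-- Induction on `≤′` raises the upper index by one at a time, matching the recursion of `maxUpTo`.
maxUpTo-mono-≤ : ∀ f {m n} → m ℕ.≤ n → maxUpTo f m ℕ.≤ maxUpTo f n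
maxUpTo-mono-≤ f = go ∘ ℕ.≤⇒≤′
  where
  go : ∀ {m n} → m ℕ.≤′ n → maxUpTo f m ℕ.≤ maxUpTo f n
  go (ℕ.≤′-reflexive ≡.refl) = ℕ.≤-refl
  go (ℕ.≤′-step m≤n)         = ℕ.≤-trans (go m≤n) (ℕ.m≤m⊔n _ _)

-- The orbit starts at the least number, so `0 ≤ s 0`, and monotonicity of `s` propagates this. The
-- argument does not rest on `n ≤ s n`, which may fail for a bounded `f`.
fold-mono-≤ : ∀ {s : ℕ → ℕ} → (∀ {m n} → m ℕ.≤ n → s m ℕ.≤ s n) →
              ∀ i → fold 0 s i ℕ.≤ fold 0 s (suc i)
fold-mono-≤ s-mono zero    = ℕ.z≤n
fold-mono-≤ s-mono (suc i) = s-mono (fold-mono-≤ s-mono i)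

-- Near-minimal distance to `v₀` among approximate fixed points, with the explicit bound.

proposition3p1 :
  ∀ {m ℓ p} → ExcludedMiddle (m ⊔ ℓ ⊔ p) →
  (ℝ : Reals) (𝕜 : ScalarField) (X : PreHilbertSpace ℝ 𝕜 m ℓ) →
  let open Reals ℝ
      open PreHilbertSpace X in
  (C : Pred Carrierᴹ p) → C Respects _≈ᴹ_ → Convex C →
  (b : ℕ) → 0 ℕ.< b → DiameterBoundedBy (fromℕ b) C →
  (U : ∃ C → ∃ C) → Nonexpansive C U →
  (v₀ : ∃ C) (k : ℕ) (f : ℕ → ℕ) →
  let r = b ℕ.^ 2 ℕ.* (k ℕ.+ 1)
      residual : ∃ C → Carrier
      residual x = ‖ proj₁ (U x) -ᴹ proj₁ x ‖
      distSq : ∃ C → Carrier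
      distSq x = ‖ proj₁ x -ᴹ proj₁ v₀ ‖ ^ 2 in
  ∃ λ (N : ℕ) → N ℕ.≤ fold 0 (λ n → maxUpTo f n ℕ.+ 1) r ×
    (∃ λ (x : ∃ C) → residual x < 1/1+ (maxUpTo f N) ×
      (∀ (y : ∃ C) → residual y ≤ 1/1+ N → distSq x < distSq y + 1/1+ k))
proposition3p1 {m} {ℓ} {p} em ℝ 𝕜 X C _ convex b 0<b bounded U nonexpansive v₀ k f =
  descent em₁ distSq 0≤distSq k (maxUpTo f) N
    (fold-mono-≤ (ℕ.+-monoˡ-≤ 1 ∘ maxUpTo-mono-≤ f)) (λ i → ℕ.+-comm (maxUpTo f (N i)) 1)
    r (proj₁ initial) (≤-<-trans (proj₂ initial) (1/1+-suc-< (maxUpTo f (N r)))) distSq≤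
  where
  open Reals ℝ
  open PreHilbertSpace X
  open RealProperties ℝ
  open PreHilbertProperties X
  open NonexpansiveProperties X U

  r : ℕ
  r = b ℕ.^ 2 ℕ.* (k ℕ.+ 1)

  N : ℕ → ℕ
  N = fold 0 (λ n → maxUpTo f n ℕ.+ 1)

  distSq : ∃ C → Carrier
  distSq x = ‖ proj₁ x -ᴹ proj₁ v₀ ‖ ^ 2

  0≤distSq : ∀ x → 0# ≤ distSq x
  0≤distSq x = ≤-respʳ-≈ (sym (‖‖-square _)) (⟨⟩-nonneg _)

  em₀ : ExcludedMiddle 0ℓ
  em₀ = excludedMiddle-lower 0ℓ (m ⊔ ℓ ⊔ p) em

  em₁ : ExcludedMiddle (m ⊔ p)
  em₁ = excludedMiddle-lower (m ⊔ p) ℓ em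

  -- The index is one more than `maxUpTo f (N r)`, which makes the bound strict at the top stage
  -- `r`.
  initial : ∃ λ x → residual x ≤ 1/1+ (suc (maxUpTo f (N r)))
  initial = approximateFixedPoint em₀ em₁ convex b 0<b bounded nonexpansive v₀ (suc (maxUpTo f (N r)))

  distSq≤ : distSq (proj₁ initial) ≤ fromℕ r * 1/1+ k
  distSq≤ = begin
    distSq x                                        ≈⟨ x^2≈x*x _ ⟩
    ‖ proj₁ x -ᴹ proj₁ v₀ ‖ * ‖ proj₁ x -ᴹ proj₁ v₀ ‖
      ≤⟨ square-mono-≤ (‖‖-nonneg _) (bounded (proj₂ x) (proj₂ v₀)) ⟩
    fromℕ b * fromℕ b                               ≈⟨ fromℕ-* b b ⟨
    -- `b ℕ.^ 2` unfolds to `b ℕ.* (b ℕ.* 1)`, so only the inner factor is rewritten.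
    fromℕ (b ℕ.* b)                                 ≡⟨ ≡.cong (λ c → fromℕ (b ℕ.* c)) (ℕ.*-identityʳ b) ⟨
    fromℕ (b ℕ.^ 2)                                 ≈⟨ *-identityʳ _ ⟨
    fromℕ (b ℕ.^ 2) * 1#                            ≈⟨ *-congˡ (1/1+-inverseʳ k) ⟨
    fromℕ (b ℕ.^ 2) * (fromℕ (suc k) * 1/1+ k)      ≈⟨ *-assoc _ _ _ ⟨
    fromℕ (b ℕ.^ 2) * fromℕ (suc k) * 1/1+ k        ≈⟨ *-congʳ (fromℕ-* (b ℕ.^ 2) (suc k)) ⟨
    fromℕ (b ℕ.^ 2 ℕ.* suc k) * 1/1+ k              ≡⟨ ≡.cong (λ c → fromℕ (b ℕ.^ 2 ℕ.* c) * 1/1+ k) (ℕ.+-comm 1 k) ⟩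
    fromℕ r * 1/1+ k                                ∎
    where
    open ≤-Reasoning
    x : ∃ C
    x = proj₁ initial
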